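{- Let $n\ge 1$ be an integer and let $[\beta(i,j)]$ be the $n\times n$ matrix with $(i,j)$th entry $\beta(i,j)$, $1\le i,j\le n$, where $\beta$ is the beta function. The inverse of $[\beta(i,j)]$ is an integer matrix (all its entries are integers), with $(i,j)$th entry given by $$(-1)^{n+i-j}\binom{n+i-1}{i-1}\binom{n}{j}\,j\sum_{1\le k\le \min(i,j)}\binom{n-k}{n-i}\binom{n+j-1}{n+k-1}(-1)^k .$$
   Context: For $x,y>0$, $\beta(x,y)=\frac{\Gamma(x)\Gamma(y)}{\Gamma(x+y)}$; for positive integers $i,j$, $\beta(i,j)=\frac{(i-1)!(j-1)!}{(i+j-1)!}$. $\binom{r}{k}$ denotes the binomial coefficient, with $\binom{0}{k}=1$ if $k=0$ and $0$ otherwise. -}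

module Defs where

open import Data.Bool.Base using (if_then_else_)
open import Data.Fin.Base using (Fin; toℕ)
open import Data.Fin.Properties using (_≟_)
open import Data.Integer.Base as ℤ using (ℤ; +_; -1ℤ)
import Data.Integer.Properties as ℤₚ
open import Data.Nat.Base using (ℕ; suc; _+_; _∸_; _⊓_; _!; NonZero)
import Data.Nat.Base as ℕ
open import Data.Nat.Combinatorics using (_C_)
open import Data.Nat.Properties using (_!≢0)
open import Data.Product.Base using (_×_)
open import Data.Rational.Base as ℚ using (ℚ; 0ℚ; 1ℚ)
open import Data.Rational.Literals using (fromℤ)
import Data.Rational.Properties as ℚₚ
open import Relation.Binary.PropositionalEquality.Core using (_≡_)
open import Relation.Nullary.Decidable.Core using (does)

import Algebra.Properties.Monoid.Sum ℚₚ.+-0-monoid as ℚΣ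
import Algebra.Properties.Monoid.Sum ℤₚ.+-0-monoid as ℤΣ

Matrix : Set → ℕ → Set
Matrix A n = Fin n → Fin n → A

1-based : ∀ {n} → Fin n → ℕ
1-based i = suc (toℕ i)

identity : ∀ {n} → Matrix ℚ n
identity i j = if does (i ≟ j) then 1ℚ else 0ℚ

infixl 7 _⊗_

_⊗_ : ∀ {n} → Matrix ℚ n → Matrix ℚ n → Matrix ℚ n
(A ⊗ B) i j = ℚΣ.sum λ k → A i k ℚ.* B k j

IsInverse : ∀ {n} → Matrix ℚ n → Matrix ℚ n → Set
IsInverse A B = (∀ i j → (A ⊗ B) i j ≡ identity i j)
              × (∀ i j → (B ⊗ A) i j ≡ identity i j)

toℚ : ∀ {n} → Matrix ℤ n → Matrix ℚ n
toℚ B i j = fromℤ (B i j)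

-- The beta function Γ(i)Γ(j)/Γ(i+j) at positive integers, where Γ(m) = (m-1)!.
β : (i j : ℕ) .{{_ : NonZero i}} .{{_ : NonZero j}} → ℚ
β i j = ℚ._/_ (+ ((i ∸ 1) ! ℕ.* (j ∸ 1) !)) ((i + j ∸ 1) !) {{(i + j ∸ 1) !≢0}}

betaMatrix : ∀ n → Matrix ℚ n
betaMatrix n i j = β (1-based i) (1-based j)

-- Here i and j are 1-based and at most n, so no subtraction
-- below is truncated.
inverseEntry : (n i j : ℕ) → ℤ
inverseEntry n i j =
  -1ℤ ℤ.^ (n + i ∸ j)
    ℤ.* + ((n + i ∸ 1) C (i ∸ 1)) ℤ.* + (n C j) ℤ.* + j
    ℤ.* ℤΣ.sum {i ⊓ j} (λ k₀ → let k = 1-based k₀ in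
          + ((n ∸ k) C (n ∸ i)) ℤ.* + ((n + j ∸ 1) C (n + k ∸ 1)) ℤ.* -1ℤ ℤ.^ k)

{-# OPTIONS --safe #-}
module Submission where

-- With indices from 0, let U have entries (-1)^i C(n+j, n+i) and L entries
-- (-1)^i C(n-1-j, n-1-i). Both are involutions by binomial inversion, so UL and
-- LU are inverse to each other. An r-th finite difference of a binomial
-- coefficient is again one, which gives (UL)ij = (-1)^(n+i+1) C(n+j, i+j+1).
-- Comparing factorials, this is the beta matrix with row i scaled by
-- (-1)^(n+i+1) (i+1) C(n, i+1) and column j scaled by C(n+j, j). Hence the
-- inverse of the beta matrix is LU with these scalings exchanged between rows
-- and columns, and writing out LU gives the formula.

open import Defs
open import Algebra.Bundles using (module Ring)
open import Algebra.Properties.CommutativeMonoid.Sum using (sum-permute)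
open import Algebra.Properties.Semiring.Sum using (*-distribˡ-sum; *-distribʳ-sum; ∑-comm; ∑-distrib-+)
open import Data.Bool.Base using (if_then_else_)
open import Data.Fin.Base using (Fin; zero; suc; toℕ)
open import Data.Fin.Permutation using (reverse)
open import Data.Fin.Properties using (_≟_; opposite-prop; toℕ<n; toℕ-injective)
open import Data.Integer.Base as ℤ using (ℤ; +_; -1ℤ; 0ℤ; 1ℤ; _+_; _*_; _^_)
import Data.Integer.Properties as ℤₚ
open import Data.Integer.Solver using (module +-*-Solver)
open import Data.Nat.Base as ℕ using (ℕ; zero; suc; _∸_; _!; NonZero; _<_; _≤_; z<s; s<s; s<s⁻¹)
open import Data.Nat.Combinatorics
  using (_C_; nCk+nC[k+1]≡[n+1]C[k+1]; k>n⇒nCk≡0; nCk≡n!/k![n-k]!; [n∸k]!k!∣n!)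
import Data.Nat.Divisibility as ℕ∣
open import Data.Nat.DivMod using (m/n*n≡m)
import Data.Nat.Properties as ℕₚ
open import Data.Nat.Solver using () renaming (module +-*-Solver to ℕS)
open import Data.Product.Base using (∃; _×_; _,_)
open import Data.Rational.Base as ℚ using (ℚ)
open import Data.Rational.Literals using (fromℤ)
import Data.Rational.Properties as ℚₚ
open import Data.Rational.Solver using () renaming (module +-*-Solver to ℚS)
import Data.Rational.Unnormalised.Base as ℚᵘ
import Data.Rational.Unnormalised.Properties as ℚᵘₚ
open import Data.Sum.Base using (inj₁; inj₂)
open import Function.Base using (_∘_)
open import Function.Definitions using (Injective)
open import Relation.Binary.PropositionalEquality
  using (_≡_; _≢_; refl; sym; trans; cong; cong₂; subst; subst₂; module ≡-Reasoning)
open import Relation.Nullary.Decidable.Core using (does; yes; no)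
open import Relation.Nullary.Negation.Core using (contradiction)

import Algebra.Properties.Monoid.Sum ℤₚ.+-0-monoid as ℤΣ
import Algebra.Properties.Monoid.Sum ℚₚ.+-0-monoid as ℚΣ

open ≡-Reasoning
open +-*-Solver using (solve; _:=_; _:*_; _:+_; con)

-- Powers of -1 and reindexing of finite sums.

sgn : ℕ → ℤ
sgn m = -1ℤ ^ m

sgn-+ : ∀ m k → sgn (m ℕ.+ k) ≡ sgn m * sgn k
sgn-+ = ℤₚ.^-distribˡ-+-* -1ℤ

sgn² : ∀ m → sgn m * sgn m ≡ 1ℤ
sgn² zero    = refl
sgn² (suc m) = trans
  (solve 1 (λ x → (con -1ℤ :* x) :* (con -1ℤ :* x) := x :* x) refl (sgn m))
  (sgn² m)

sgn-∸ : ∀ {m n} → m ≤ n → sgn (n ∸ m) ≡ sgn n * sgn m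
sgn-∸ {m} {n} m≤n = begin
  sgn (n ∸ m)                        ≡⟨ ℤₚ.*-identityʳ _ ⟨
  sgn (n ∸ m) * 1ℤ                   ≡⟨ cong (sgn (n ∸ m) *_) (sgn² m) ⟨
  sgn (n ∸ m) * (sgn m * sgn m)      ≡⟨ ℤₚ.*-assoc (sgn (n ∸ m)) _ _ ⟨
  sgn (n ∸ m) * sgn m * sgn m        ≡⟨ cong (_* sgn m) (sgn-+ (n ∸ m) m) ⟨
  sgn (n ∸ m ℕ.+ m) * sgn m          ≡⟨ cong (λ l → sgn l * sgn m) (ℕₚ.m∸n+n≡m m≤n) ⟩
  sgn n * sgn m                      ∎

∑-drop : ∀ m {n} (g : ℕ → ℤ) → (∀ k → k < m → g k ≡ 0ℤ) →
         ℤΣ.sum {m ℕ.+ n} (g ∘ toℕ) ≡ ℤΣ.sum {n} (λ i → g (m ℕ.+ toℕ i))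
∑-drop zero    g g≡0 = refl
∑-drop (suc m) {n} g g≡0 = trans
  (cong₂ _+_ (g≡0 0 z<s) (∑-drop m {n} (g ∘ suc) (λ k k<m → g≡0 (suc k) (s<s k<m))))
  (ℤₚ.+-identityˡ _)

∑-zero : ∀ {n} (f : Fin n → ℤ) → (∀ i → f i ≡ 0ℤ) → ℤΣ.sum f ≡ 0ℤ
∑-zero {n} f f≡0 = trans (ℤΣ.sum-cong-≗ f≡0) (ℤΣ.sum-replicate-zero n)

∑-take : ∀ {m n} (g : ℕ → ℤ) → m ≤ n → (∀ k → m ≤ k → k < n → g k ≡ 0ℤ) →
         ℤΣ.sum {m} (g ∘ toℕ) ≡ ℤΣ.sum {n} (g ∘ toℕ)
∑-take {zero}  {n}     g m≤n g≡0 = sym (∑-zero (g ∘ toℕ) (λ i → g≡0 (toℕ i) ℕ.z≤n (toℕ<n i)))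
∑-take {suc m} {suc n} g m≤n g≡0 = cong (λ z → g 0 + z)
  (∑-take (g ∘ suc) (ℕ.s≤s⁻¹ m≤n) (λ k m≤k k<n → g≡0 (suc k) (ℕ.s≤s m≤k) (s<s k<n)))

∑-reverse : ∀ n (g : ℕ → ℤ) → ℤΣ.sum {n} (g ∘ toℕ) ≡ ℤΣ.sum {n} (λ i → g (n ∸ suc (toℕ i)))
∑-reverse n g = trans
  (sum-permute ℤₚ.+-0-commutativeMonoid (g ∘ toℕ) (reverse {n}))
  (ℤΣ.sum-cong-≗ (λ i → cong g (opposite-prop {n} i)))

-- Finite differences of binomial coefficients.

-- For r < n this is the r-th finite difference of f at 0, up to the sign (-1)^r.
altΣ : ℕ → ℕ → (ℕ → ℤ) → ℤ
altΣ n r f = ℤΣ.sum {n} λ i → sgn (toℕ i) * + (r C toℕ i) * f (toℕ i)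

altΣ-cong : ∀ n r {f g} → (∀ m → m < n → f m ≡ g m) → altΣ n r f ≡ altΣ n r g
altΣ-cong n r f≗g = ℤΣ.sum-cong-≗ λ i → cong (sgn (toℕ i) * + (r C toℕ i) *_) (f≗g (toℕ i) (toℕ<n i))

altΣ-zero : ∀ n f → altΣ (suc n) 0 f ≡ f 0
altΣ-zero n f = begin
  1ℤ * 1ℤ * f 0 + ℤΣ.sum {n} _  ≡⟨ cong₂ _+_ (ℤₚ.*-identityˡ (f 0)) (∑-zero {n} _ (λ i → cong (_* f (suc (toℕ i))) (ℤₚ.*-zeroʳ (sgn (suc (toℕ i)))))) ⟩
  f 0 + 0ℤ                      ≡⟨ ℤₚ.+-identityʳ (f 0) ⟩
  f 0                           ∎

-- Pascal's rule splits each coefficient `suc r C suc i`; the part with `r C i` is the same kind of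
-- sum for the shifted function. The shift uses up one index, so that sum has length `n`.
altΣ-suc : ∀ n r f → altΣ (suc n) (suc r) f ≡ altΣ (suc n) r f + -1ℤ * altΣ n r (f ∘ suc)
altΣ-suc n r f = begin
  f₀ + ℤΣ.sum {n} (λ i → sgn (suc (toℕ i)) * + (suc r C suc (toℕ i)) * f (suc (toℕ i)))
    ≡⟨ cong (λ z → f₀ + z) (ℤΣ.sum-cong-≗ {n} pascal) ⟩
  f₀ + ℤΣ.sum (λ i → t i + -1ℤ * u i)
    ≡⟨ cong (λ z → f₀ + z) (∑-distrib-+ ℤₚ.+-*-semiring t (λ i → -1ℤ * u i)) ⟩
  f₀ + (ℤΣ.sum t + ℤΣ.sum (λ i → -1ℤ * u i))
    ≡⟨ ℤₚ.+-assoc f₀ _ _ ⟨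
  f₀ + ℤΣ.sum t + ℤΣ.sum (λ i → -1ℤ * u i)
    ≡⟨ cong (λ z → altΣ (suc n) r f + z) (*-distribˡ-sum ℤₚ.+-*-semiring -1ℤ u) ⟨
  altΣ (suc n) r f + -1ℤ * altΣ n r (f ∘ suc)
    ∎
  where
  f₀ = 1ℤ * 1ℤ * f 0
  t u : Fin n → ℤ
  t i = sgn (suc (toℕ i)) * + (r C suc (toℕ i)) * f (suc (toℕ i))
  u i = sgn (toℕ i) * + (r C toℕ i) * f (suc (toℕ i))
  pascal : ∀ i → sgn (suc (toℕ i)) * + (suc r C suc (toℕ i)) * f (suc (toℕ i)) ≡ t i + -1ℤ * u i
  pascal i = trans
    (cong (λ c → sgn (suc (toℕ i)) * + c * f (suc (toℕ i))) (sym (nCk+nC[k+1]≡[n+1]C[k+1] r (toℕ i))))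
    (solve 4 (λ s c d x → con -1ℤ :* s :* (c :+ d) :* x
                       := con -1ℤ :* s :* d :* x :+ con -1ℤ :* (s :* c :* x)) refl
      (sgn (toℕ i)) (+ (r C toℕ i)) (+ (r C suc (toℕ i))) (f (suc (toℕ i))))

-- C↓ s q r is the binomial coefficient s over q - r, zero when q < r.
C↓ : ℕ → ℕ → ℕ → ℤ
C↓ s q       zero    = + (s C q)
C↓ s zero    (suc r) = 0ℤ
C↓ s (suc q) (suc r) = C↓ s q r

-- This is why `C↓` has to vanish for `q < r`: at `q = r` the rule reads 1 = 1 + 0, where the
-- truncated bottom `q ∸ suc r` would give 1 + 1.
C↓-pascal : ∀ s q r → C↓ (suc s) q r ≡ C↓ s q r + C↓ s q (suc r)
C↓-pascal s zero    zero    = refl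
C↓-pascal s (suc q) zero    = cong +_ (trans (sym (nCk+nC[k+1]≡[n+1]C[k+1] s q)) (ℕₚ.+-comm (s C q) _))
C↓-pascal s zero    (suc r) = refl
C↓-pascal s (suc q) (suc r) = C↓-pascal s q r

C↓-+ : ∀ s r t → C↓ s (r ℕ.+ t) r ≡ + (s C t)
C↓-+ s zero    t = refl
C↓-+ s (suc r) t = C↓-+ s r t

-- With top 0 the only nonzero binomial coefficient has bottom 0, so `C↓ 0 q r` acts as a Kronecker
-- delta. Binomial inversion rests on this.
C↓-0-≢ : ∀ {q r} → q ≢ r → C↓ 0 q r ≡ 0ℤ
C↓-0-≢ {zero}  {zero}  q≢r = contradiction refl q≢r
C↓-0-≢ {suc q} {zero}  q≢r = refl
C↓-0-≢ {zero}  {suc r} q≢r = refl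
C↓-0-≢ {suc q} {suc r} q≢r = C↓-0-≢ (q≢r ∘ cong suc)

-- Induction on `r`: by Pascal's rule each difference in `s` lowers the bottom by one. The factor
-- `sgn r` is there because `altΣ` gives `f 0` the sign +, while the forward difference gives it to
-- `f r`.
altΣ-increasing : ∀ {n} s q r → r < n → altΣ n r (λ m → + ((s ℕ.+ m) C q)) ≡ sgn r * C↓ s q r
altΣ-increasing {suc n} s q zero r<n = begin
  altΣ (suc n) 0 (λ m → + ((s ℕ.+ m) C q))  ≡⟨ altΣ-zero n (λ m → + ((s ℕ.+ m) C q)) ⟩
  + ((s ℕ.+ 0) C q)                         ≡⟨ cong (λ l → + (l C q)) (ℕₚ.+-identityʳ s) ⟩
  + (s C q)                                 ≡⟨ ℤₚ.*-identityˡ _ ⟨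
  1ℤ * + (s C q)                            ∎
altΣ-increasing {suc n} s q (suc r) r<n = begin
  altΣ (suc n) (suc r) f
    ≡⟨ altΣ-suc n r f ⟩
  altΣ (suc n) r f + -1ℤ * altΣ n r (f ∘ suc)
    ≡⟨ cong (λ x → altΣ (suc n) r f + -1ℤ * x) (altΣ-cong n r (λ m _ → cong (λ l → + (l C q)) (ℕₚ.+-suc s m))) ⟩
  altΣ (suc n) r f + -1ℤ * altΣ n r (λ m → + ((suc s ℕ.+ m) C q))
    ≡⟨ cong₂ (λ x y → x + -1ℤ * y) (altΣ-increasing s q r (ℕₚ.<-trans (ℕₚ.n<1+n r) r<n)) (altΣ-increasing (suc s) q r (s<s⁻¹ r<n)) ⟩
  sgn r * C↓ s q r + -1ℤ * (sgn r * C↓ (suc s) q r)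
    ≡⟨ cong (λ x → sgn r * C↓ s q r + -1ℤ * (sgn r * x)) (C↓-pascal s q r) ⟩
  sgn r * C↓ s q r + -1ℤ * (sgn r * (C↓ s q r + C↓ s q (suc r)))
    ≡⟨ solve 3 (λ x y z → x :* y :+ con -1ℤ :* (x :* (y :+ z)) := con -1ℤ :* x :* z) refl (sgn r) (C↓ s q r) (C↓ s q (suc r)) ⟩
  sgn (suc r) * C↓ s q (suc r)
    ∎
  where
  f : ℕ → ℤ
  f m = + ((s ℕ.+ m) C q)

-- The tops run down from `s + r` to `s`, so the sign + falls on the largest and no `sgn r` remains.
-- Truncation in `s + r ∸ m` is harmless: it can only occur for `m > r`, where `r C m` is zero.
altΣ-decreasing : ∀ {n} s q r → r < n → altΣ n r (λ m → + ((s ℕ.+ r ∸ m) C q)) ≡ C↓ s q r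
altΣ-decreasing {suc n} s q zero r<n =
  trans (altΣ-zero n (λ m → + ((s ℕ.+ 0 ∸ m) C q))) (cong (λ l → + (l C q)) (ℕₚ.+-identityʳ s))
altΣ-decreasing {suc n} s q (suc r) r<n = begin
  altΣ (suc n) (suc r) (λ m → + ((s ℕ.+ suc r ∸ m) C q))
    ≡⟨ altΣ-cong (suc n) (suc r) (λ m _ → cong (λ l → + ((l ∸ m) C q)) (ℕₚ.+-suc s r)) ⟩
  altΣ (suc n) (suc r) (λ m → + ((suc s ℕ.+ r ∸ m) C q))
    ≡⟨ altΣ-suc n r (λ m → + ((suc s ℕ.+ r ∸ m) C q)) ⟩
  altΣ (suc n) r (λ m → + ((suc s ℕ.+ r ∸ m) C q)) + -1ℤ * altΣ n r (λ m → + ((s ℕ.+ r ∸ m) C q))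
    ≡⟨ cong₂ (λ x y → x + -1ℤ * y) (altΣ-decreasing (suc s) q r (ℕₚ.<-trans (ℕₚ.n<1+n r) r<n)) (altΣ-decreasing s q r (s<s⁻¹ r<n)) ⟩
  C↓ (suc s) q r + -1ℤ * C↓ s q r
    ≡⟨ cong (_+ -1ℤ * C↓ s q r) (C↓-pascal s q r) ⟩
  C↓ s q r + C↓ s q (suc r) + -1ℤ * C↓ s q r
    ≡⟨ solve 2 (λ x y → x :+ y :+ con -1ℤ :* x := y) refl (C↓ s q r) (C↓ s q (suc r)) ⟩
  C↓ s q (suc r)
    ∎

-- Integer matrices and products of involutions.

δ : ∀ {n} → Matrix ℤ n
δ i j = if does (i ≟ j) then 1ℤ else 0ℤ

-- Common last step of `upper²` and `lower²`, with `h` the bottom index of their binomial entries.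
-- On the diagonal the two signs cancel; off it, injectivity of `h` gives zero.
sgn*C↓-0≡δ : ∀ {n} (h : Fin n → ℕ) → Injective _≡_ _≡_ h →
           ∀ i j → sgn (toℕ i) * (sgn (toℕ j) * C↓ 0 (h i) (h j)) ≡ δ i j
sgn*C↓-0≡δ h h-inj i j with i ≟ j
... | yes refl = begin
  sgn (toℕ i) * (sgn (toℕ i) * C↓ 0 (h i) (h i))  ≡⟨ ℤₚ.*-assoc (sgn (toℕ i)) _ _ ⟨
  sgn (toℕ i) * sgn (toℕ i) * C↓ 0 (h i) (h i)    ≡⟨ cong₂ _*_ (sgn² (toℕ i)) (trans (cong (λ q → C↓ 0 q (h i)) (sym (ℕₚ.+-identityʳ (h i)))) (C↓-+ 0 (h i) 0)) ⟩
  1ℤ                                              ∎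
... | no i≢j = trans
  (cong (λ x → sgn (toℕ i) * (sgn (toℕ j) * x)) (C↓-0-≢ (i≢j ∘ h-inj)))
  (trans (cong (sgn (toℕ i) *_) (ℤₚ.*-zeroʳ (sgn (toℕ j)))) (ℤₚ.*-zeroʳ (sgn (toℕ i))))

infixl 7 _·_
_·_ : ∀ {n} → Matrix ℤ n → Matrix ℤ n → Matrix ℤ n
(A · B) i j = ℤΣ.sum λ k → A i k * B k j

·-assoc : ∀ {n} (A B C : Matrix ℤ n) i j → ((A · B) · C) i j ≡ (A · (B · C)) i j
·-assoc A B C i j = begin
  ℤΣ.sum (λ k → ℤΣ.sum (λ l → A i l * B l k) * C k j)
    ≡⟨ ℤΣ.sum-cong-≗ (λ k → *-distribʳ-sum ℤₚ.+-*-semiring (C k j) (λ l → A i l * B l k)) ⟩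
  ℤΣ.sum (λ k → ℤΣ.sum (λ l → A i l * B l k * C k j))
    ≡⟨ ∑-comm ℤₚ.+-*-semiring (λ k l → A i l * B l k * C k j) ⟩
  ℤΣ.sum (λ l → ℤΣ.sum (λ k → A i l * B l k * C k j))
    ≡⟨ ℤΣ.sum-cong-≗ (λ l → trans
         (ℤΣ.sum-cong-≗ (λ k → ℤₚ.*-assoc (A i l) (B l k) (C k j)))
         (sym (*-distribˡ-sum ℤₚ.+-*-semiring (A i l) (λ k → B l k * C k j)))) ⟩
  ℤΣ.sum (λ l → A i l * ℤΣ.sum (λ k → B l k * C k j))
    ∎

∑-δˡ : ∀ {n} (i : Fin n) (x : Fin n → ℤ) → ℤΣ.sum (λ k → δ i k * x k) ≡ x i
∑-δˡ zero x = trans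
  (cong₂ _+_ (ℤₚ.*-identityˡ (x zero)) (∑-zero (λ k → 0ℤ * x (suc k)) (λ k → refl)))
  (ℤₚ.+-identityʳ (x zero))
∑-δˡ (suc i) x = trans (ℤₚ.+-identityˡ _) (∑-δˡ i (x ∘ suc))

·-involution : ∀ {n} (A B : Matrix ℤ n) → (∀ i j → (A · A) i j ≡ δ i j) →
               ∀ i j → (A · (A · B)) i j ≡ B i j
·-involution A B A²≡δ i j = begin
  (A · (A · B)) i j                ≡⟨ ·-assoc A A B i j ⟨
  (A · A · B) i j                  ≡⟨ ℤΣ.sum-cong-≗ (λ k → cong (_* B k j) (A²≡δ i k)) ⟩
  ℤΣ.sum (λ k → δ i k * B k j)     ≡⟨ ∑-δˡ i (λ k → B k j) ⟩
  B i j                            ∎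

-- The middle factor `B · B` collapses first, and then `A · A`.
·-involutions-inverse : ∀ {n} (A B : Matrix ℤ n) →
  (∀ i j → (A · A) i j ≡ δ i j) → (∀ i j → (B · B) i j ≡ δ i j) →
  ∀ i j → ((A · B) · (B · A)) i j ≡ δ i j
·-involutions-inverse A B A²≡δ B²≡δ i j = begin
  ((A · B) · (B · A)) i j  ≡⟨ ·-assoc A B (B · A) i j ⟩
  (A · (B · (B · A))) i j  ≡⟨ ℤΣ.sum-cong-≗ (λ k → cong (A i k *_) (·-involution B A B²≡δ k j)) ⟩
  (A · A) i j              ≡⟨ A²≡δ i j ⟩
  δ i j                    ∎

-- The two binomial involutions and their product.

upper lower : ∀ n → Matrix ℤ n
upper n i j = sgn (toℕ i) * + ((n ℕ.+ toℕ j) C (n ℕ.+ toℕ i))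
lower n i j = sgn (toℕ i) * + ((n ∸ 1-based j) C (n ∸ 1-based i))

-- Binomial inversion on the indices from `n` upwards. Once the sum is extended down to index 0 it
-- is an `r`-th difference of `m C q` at 0, with `r < n + n`.
upper² : ∀ n i j → (upper n · upper n) i j ≡ δ i j
upper² n i j = begin
  ℤΣ.sum {n} (λ k → σi * + ((n ℕ.+ toℕ k) C q) * (sgn (toℕ k) * + (r C (n ℕ.+ toℕ k))))
    -- Inserting `sgn n * sgn n` turns (-1)^k into (-1)^(n+k), so that the summand depends on
    -- `n + k` alone.
    ≡⟨ ℤΣ.sum-cong-≗ {n} (λ k → shift (toℕ k)) ⟩
  ℤΣ.sum {n} (λ k → σi * sgn n * g (n ℕ.+ toℕ k))
    ≡⟨ *-distribˡ-sum ℤₚ.+-*-semiring (σi * sgn n) (λ (k : Fin n) → g (n ℕ.+ toℕ k)) ⟨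
  σi * sgn n * ℤΣ.sum {n} (λ k → g (n ℕ.+ toℕ k))
    -- The added terms, with `k < n`, vanish through `k C q`, since `q` is at least `n`.
    ≡⟨ cong (σi * sgn n *_) (∑-drop n g (λ k k<n → trans (cong (λ x → sgn k * + (r C k) * + x) (k>n⇒nCk≡0 (ℕₚ.<-≤-trans k<n (ℕₚ.m≤m+n n (toℕ i))))) (ℤₚ.*-zeroʳ (sgn k * + (r C k))))) ⟨
  σi * sgn n * altΣ (n ℕ.+ n) r (λ m → + (m C q))
    ≡⟨ cong (σi * sgn n *_) (altΣ-increasing 0 q r (ℕₚ.+-monoʳ-< n (toℕ<n j))) ⟩
  σi * sgn n * (sgn r * C↓ 0 q r)
    ≡⟨ cong (λ x → σi * sgn n * (x * C↓ 0 q r)) (sgn-+ n (toℕ j)) ⟩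
  σi * sgn n * (sgn n * sgn (toℕ j) * C↓ 0 q r)
    ≡⟨ solve 4 (λ a b c d → a :* b :* (b :* c :* d) := b :* b :* (a :* (c :* d))) refl σi (sgn n) (sgn (toℕ j)) (C↓ 0 q r) ⟩
  sgn n * sgn n * (σi * (sgn (toℕ j) * C↓ 0 q r))
    ≡⟨ cong₂ _*_ (sgn² n) (sgn*C↓-0≡δ (λ k → n ℕ.+ toℕ k) (toℕ-injective ∘ ℕₚ.+-cancelˡ-≡ n _ _) i j) ⟩
  1ℤ * δ i j
    ≡⟨ ℤₚ.*-identityˡ _ ⟩
  δ i j
    ∎
  where
  σi = sgn (toℕ i)
  q = n ℕ.+ toℕ i
  r = n ℕ.+ toℕ j
  g : ℕ → ℤ
  g m = sgn m * + (r C m) * + (m C q)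
  shift : ∀ k → σi * + ((n ℕ.+ k) C q) * (sgn k * + (r C (n ℕ.+ k))) ≡ σi * sgn n * g (n ℕ.+ k)
  shift k = begin
    σi * x * (sgn k * y)                         ≡⟨ solve 4 (λ a b c d → a :* b :* (c :* d) := con 1ℤ :* (a :* (c :* d :* b))) refl σi x (sgn k) y ⟩
    1ℤ * (σi * (sgn k * y * x))                  ≡⟨ cong (_* (σi * (sgn k * y * x))) (sgn² n) ⟨
    sgn n * sgn n * (σi * (sgn k * y * x))       ≡⟨ solve 5 (λ a b c d e → e :* e :* (a :* (c :* d :* b)) := a :* e :* (e :* c :* d :* b)) refl σi x (sgn k) y (sgn n) ⟩
    σi * sgn n * (sgn n * sgn k * y * x)         ≡⟨ cong (λ z → σi * sgn n * (z * y * x)) (sgn-+ n k) ⟨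
    σi * sgn n * (sgn (n ℕ.+ k) * y * x)         ∎
    where
    x = + ((n ℕ.+ k) C q)
    y = + (r C (n ℕ.+ k))

n∸1+[n∸1+k]≡k : ∀ {n k} → k < n → n ∸ suc (n ∸ suc k) ≡ k
n∸1+[n∸1+k]≡k {suc n} {k} k<n = ℕₚ.m∸[m∸n]≡n (ℕ.s≤s⁻¹ k<n)

-- Substituting `n - 1 - m` for `k` turns column `j` of `lower` into the coefficients `r C m` with
-- `r = n - 1 - j`, and its sign into (-1)^(n+1) (-1)^m. Multiplying by `lower` on the right thus
-- takes a finite difference of the reversed row.
∑-lower : ∀ n (h : ℕ → ℤ) x j →
  ℤΣ.sum (λ k → x * h (toℕ k) * lower n k j)
    ≡ x * (sgn (suc n) * altΣ n (n ∸ 1-based j) (λ m → h (n ∸ suc m)))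
∑-lower n h x j = begin
  ℤΣ.sum {n} (g ∘ toℕ)
    ≡⟨ ∑-reverse n g ⟩
  ℤΣ.sum {n} (λ k → g (n ∸ suc (toℕ k)))
    ≡⟨ ℤΣ.sum-cong-≗ {n} term ⟩
  ℤΣ.sum {n} (λ k → x * sgn (suc n) * t k)
    ≡⟨ *-distribˡ-sum ℤₚ.+-*-semiring (x * sgn (suc n)) t ⟨
  x * sgn (suc n) * ℤΣ.sum {n} t
    ≡⟨ ℤₚ.*-assoc x _ _ ⟩
  x * (sgn (suc n) * ℤΣ.sum {n} t)
    ∎
  where
  r = n ∸ 1-based j
  g : ℕ → ℤ
  g k = x * h k * (sgn k * + (r C (n ∸ suc k)))
  t : Fin n → ℤ
  t k = sgn (toℕ k) * + (r C toℕ k) * h (n ∸ suc (toℕ k))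
  term : ∀ k → g (n ∸ suc (toℕ k)) ≡ x * sgn (suc n) * t k
  term k = begin
    x * y * (sgn (n ∸ suc (toℕ k)) * + (r C (n ∸ suc (n ∸ suc (toℕ k)))))
      ≡⟨ cong₂ (λ s m → x * y * (s * + (r C m))) (sgn-∸ (toℕ<n k)) (n∸1+[n∸1+k]≡k (toℕ<n k)) ⟩
    x * y * (sgn n * (-1ℤ * sgn (toℕ k)) * + (r C toℕ k))
      ≡⟨ solve 5 (λ x y s u c → x :* y :* (s :* (con -1ℤ :* u) :* c) := x :* (con -1ℤ :* s) :* (u :* c :* y)) refl x y (sgn n) (sgn (toℕ k)) (+ (r C toℕ k)) ⟩
    x * sgn (suc n) * t k
      ∎
    where y = h (n ∸ suc (toℕ k))

n∸1-based<n : ∀ {n} (j : Fin n) → n ∸ 1-based j < n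
n∸1-based<n {suc n} j = ℕ.s≤s (ℕₚ.m∸n≤m n (toℕ j))

-- Reversal turns the top `n - 1 - k` into `m`, which leaves the `r`-th difference of `m C q` at 0.
lower² : ∀ n i j → (lower n · lower n) i j ≡ δ i j
lower² n i j = begin
  (lower n · lower n) i j
    ≡⟨ ∑-lower n (λ k → + ((n ∸ suc k) C q)) σi j ⟩
  σi * (sgn (suc n) * altΣ n r (λ m → + ((n ∸ suc (n ∸ suc m)) C q)))
    ≡⟨ cong (λ x → σi * (sgn (suc n) * x)) (altΣ-cong n r (λ m m<n → cong (λ l → + (l C q)) (n∸1+[n∸1+k]≡k m<n))) ⟩
  σi * (sgn (suc n) * altΣ n r (λ m → + (m C q)))
    ≡⟨ cong (λ x → σi * (sgn (suc n) * x)) (altΣ-increasing 0 q r (n∸1-based<n j)) ⟩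
  σi * (sgn (suc n) * (sgn r * C↓ 0 q r))
    -- As `r = n - 1 - j`, the signs of `suc n` and `r` multiply to (-1)^j.
    ≡⟨ cong (λ x → σi * (sgn (suc n) * (x * C↓ 0 q r))) (sgn-∸ (toℕ<n j)) ⟩
  σi * (-1ℤ * sgn n * (sgn n * (-1ℤ * sgn (toℕ j)) * C↓ 0 q r))
    ≡⟨ solve 4 (λ a b c d → a :* (con -1ℤ :* b :* (b :* (con -1ℤ :* c) :* d)) := b :* b :* (a :* (c :* d))) refl σi (sgn n) (sgn (toℕ j)) (C↓ 0 q r) ⟩
  sgn n * sgn n * (σi * (sgn (toℕ j) * C↓ 0 q r))
    ≡⟨ cong₂ _*_ (sgn² n) (sgn*C↓-0≡δ (λ k → n ∸ 1-based k) inj i j) ⟩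
  1ℤ * δ i j
    ≡⟨ ℤₚ.*-identityˡ _ ⟩
  δ i j
    ∎
  where
  σi = sgn (toℕ i)
  q = n ∸ 1-based i
  r = n ∸ 1-based j
  inj : Injective _≡_ _≡_ (λ (k : Fin n) → n ∸ 1-based k)
  inj {k} {l} eq = toℕ-injective (ℕₚ.suc-injective (ℕₚ.∸-cancelˡ-≡ (toℕ<n k) (toℕ<n l) eq))

-- Read backwards, row `i` of `upper` has decreasing tops, so `altΣ-decreasing` applies. The
-- `n - 1 - j` differences lower the bottom from `n + i` to `i + j + 1` and leave the top `n + j`.
upper·lower : ∀ n i j → (upper n · lower n) i j ≡
  sgn (n ℕ.+ 1-based i) * + ((n ℕ.+ toℕ j) C suc (toℕ j ℕ.+ toℕ i))
upper·lower n i j = begin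
  (upper n · lower n) i j
    ≡⟨ ∑-lower n (λ k → + ((n ℕ.+ k) C q)) (sgn a) j ⟩
  sgn a * (sgn (suc n) * altΣ n r (λ m → + ((n ℕ.+ (n ∸ suc m)) C q)))
    -- Since `n - 1 = b + r`, the tops take the form `s + r ∸ m` with `s = n + b`.
    ≡⟨ cong (λ x → sgn a * (sgn (suc n) * x)) (altΣ-cong n r (λ m m<n → cong (λ l → + (l C q)) (index m<n))) ⟩
  sgn a * (sgn (suc n) * altΣ n r (λ m → + ((n ℕ.+ b ℕ.+ r ∸ m) C q)))
    ≡⟨ cong (λ x → sgn a * (sgn (suc n) * x)) (altΣ-decreasing (n ℕ.+ b) q r (n∸1-based<n j)) ⟩
  sgn a * (sgn (suc n) * C↓ (n ℕ.+ b) q r)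
    ≡⟨ cong (λ x → sgn a * (sgn (suc n) * C↓ (n ℕ.+ b) x r)) q≡ ⟩
  sgn a * (sgn (suc n) * C↓ (n ℕ.+ b) (r ℕ.+ suc (b ℕ.+ a)) r)
    ≡⟨ cong (λ x → sgn a * (sgn (suc n) * x)) (C↓-+ (n ℕ.+ b) r (suc (b ℕ.+ a))) ⟩
  sgn a * (sgn (suc n) * + ((n ℕ.+ b) C suc (b ℕ.+ a)))
    ≡⟨ solve 3 (λ x y z → x :* (con -1ℤ :* y :* z) := y :* (con -1ℤ :* x) :* z) refl (sgn a) (sgn n) (+ ((n ℕ.+ b) C suc (b ℕ.+ a))) ⟩
  sgn n * sgn (suc a) * + ((n ℕ.+ b) C suc (b ℕ.+ a))
    ≡⟨ cong (_* + ((n ℕ.+ b) C suc (b ℕ.+ a))) (sgn-+ n (suc a)) ⟨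
  sgn (n ℕ.+ suc a) * + ((n ℕ.+ b) C suc (b ℕ.+ a))
    ∎
  where
  a = toℕ i
  b = toℕ j
  q = n ℕ.+ a
  r = n ∸ suc b
  n≡ : r ℕ.+ suc b ≡ n
  n≡ = ℕₚ.m∸n+n≡m (toℕ<n j)
  q≡ : q ≡ r ℕ.+ suc (b ℕ.+ a)
  q≡ = trans (cong (ℕ._+ a) (sym n≡)) (ℕₚ.+-assoc r (suc b) a)
  index : ∀ {m} → m < n → n ℕ.+ (n ∸ suc m) ≡ n ℕ.+ b ℕ.+ r ∸ m
  index {m} m<n = begin
    n ℕ.+ (n ∸ suc m)              ≡⟨ ℕₚ.+-∸-assoc n m<n ⟨
    n ℕ.+ n ∸ suc m                ≡⟨ cong (λ x → n ℕ.+ x ∸ suc m) (trans (sym n≡) (ℕₚ.+-comm r (suc b))) ⟩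
    n ℕ.+ suc (b ℕ.+ r) ∸ suc m    ≡⟨ cong (_∸ suc m) (ℕₚ.+-suc n (b ℕ.+ r)) ⟩
    n ℕ.+ (b ℕ.+ r) ∸ m            ≡⟨ cong (_∸ m) (ℕₚ.+-assoc n b r) ⟨
    n ℕ.+ b ℕ.+ r ∸ m              ∎

-- Binomial coefficients and factorials.

nCk*k!*l!≡n! : ∀ k l → ((k ℕ.+ l) C k) ℕ.* (k ! ℕ.* l !) ≡ (k ℕ.+ l) !
nCk*k!*l!≡n! k l = subst (λ m → (n C k) ℕ.* (k ! ℕ.* m !) ≡ n !) (ℕₚ.m+n∸m≡n k l) (begin
  (n C k) ℕ.* (k ! ℕ.* (n ∸ k) !)
    ≡⟨ cong (ℕ._* (k ! ℕ.* (n ∸ k) !)) (nCk≡n!/k![n-k]! k≤n) ⟩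
  (n ! ℕ./ (k ! ℕ.* (n ∸ k) !)) ℕ.* (k ! ℕ.* (n ∸ k) !)
    ≡⟨ m/n*n≡m (subst (ℕ∣._∣ n !) (ℕₚ.*-comm ((n ∸ k) !) (k !)) ([n∸k]!k!∣n! k≤n)) ⟩
  n ! ∎)
  where
  n = k ℕ.+ l
  k≤n = ℕₚ.m≤m+n k l
  instance _ = k ℕₚ.!* (n ∸ k) !≢0

-- It is a factor of `n !`, which is nonzero.
nCk≢0 : ∀ {n k} → k ≤ n → ℕ.NonZero (n C k)
nCk≢0 {n} {k} k≤n = subst (λ m → ℕ.NonZero (m C k)) (ℕₚ.m+[n∸m]≡n k≤n)
  (ℕₚ.m*n≢0⇒m≢0 ((k ℕ.+ (n ∸ k)) C k)
    {{subst ℕ.NonZero (sym (nCk*k!*l!≡n! k (n ∸ k))) ((k ℕ.+ (n ∸ k)) ℕₚ.!≢0)}})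

-- Multiplied by p! n!, both sides become n! (n + b)!.
binomial-factorials : ∀ a b p → let n = suc a ℕ.+ p in
  (n C suc a) ℕ.* suc a ℕ.* (a ! ℕ.* b !) ℕ.* ((n ℕ.+ b) C b)
    ≡ ((n ℕ.+ b) C suc (b ℕ.+ a)) ℕ.* (a ℕ.+ suc b) !
binomial-factorials a b p = ℕₚ.*-cancelʳ-≡ _ _ (p ! ℕ.* n !) (begin
  c₁ ℕ.* suc a ℕ.* (a ! ℕ.* b !) ℕ.* c₂ ℕ.* (p ! ℕ.* n !)
    ≡⟨ ℕS.solve 7 (λ c s x y d z w → c ℕS.:* s ℕS.:* (x ℕS.:* y) ℕS.:* d ℕS.:* (z ℕS.:* w) ℕS.:= c ℕS.:* (s ℕS.:* x ℕS.:* z) ℕS.:* (d ℕS.:* (y ℕS.:* w))) refl c₁ (suc a) (a !) (b !) c₂ (p !) (n !) ⟩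
  c₁ ℕ.* (suc a ! ℕ.* p !) ℕ.* (c₂ ℕ.* (b ! ℕ.* n !))
    ≡⟨ cong₂ ℕ._*_ (nCk*k!*l!≡n! (suc a) p) c₂-eq ⟩
  n ! ℕ.* (n ℕ.+ b) !
    ≡⟨ cong (n ! ℕ.*_) c₃-eq ⟨
  n ! ℕ.* (c₃ ℕ.* ((a ℕ.+ suc b) ! ℕ.* p !))
    ≡⟨ ℕS.solve 4 (λ w c y z → w ℕS.:* (c ℕS.:* (y ℕS.:* z)) ℕS.:= c ℕS.:* y ℕS.:* (z ℕS.:* w)) refl (n !) c₃ ((a ℕ.+ suc b) !) (p !) ⟩
  c₃ ℕ.* (a ℕ.+ suc b) ! ℕ.* (p ! ℕ.* n !)
    ∎)
  where
  n = suc a ℕ.+ p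
  c₁ = n C suc a
  c₂ = (n ℕ.+ b) C b
  c₃ = (n ℕ.+ b) C suc (b ℕ.+ a)
  instance _ = p ℕₚ.!* n !≢0
  c₂-eq : c₂ ℕ.* (b ! ℕ.* n !) ≡ (n ℕ.+ b) !
  c₂-eq = subst (λ m → (m C b) ℕ.* (b ! ℕ.* n !) ≡ m !) (ℕₚ.+-comm b n) (nCk*k!*l!≡n! b n)
  c₃-eq : c₃ ℕ.* ((a ℕ.+ suc b) ! ℕ.* p !) ≡ (n ℕ.+ b) !
  c₃-eq = subst₂ (λ m k → (m C suc (b ℕ.+ a)) ℕ.* (k ! ℕ.* p !) ≡ m !)
    (ℕS.solve 3 (λ x y z → ℕS.con 1 ℕS.:+ (y ℕS.:+ x) ℕS.:+ z ℕS.:= ℕS.con 1 ℕS.:+ x ℕS.:+ z ℕS.:+ y) refl a b p)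
    (trans (cong suc (ℕₚ.+-comm b a)) (sym (ℕₚ.+-suc a b)))
    (nCk*k!*l!≡n! (suc (b ℕ.+ a)) p)

-- Integers inside the rationals.

fromℤ-+ : ∀ x y → fromℤ (x + y) ≡ fromℤ x ℚ.+ fromℤ y
fromℤ-+ x y = trans
  (cong fromℤ (sym (cong₂ _+_ (ℤₚ.*-identityʳ x) (ℤₚ.*-identityʳ y))))
  (sym (ℚₚ.↥p/↧p≡p (fromℤ (x * 1ℤ + y * 1ℤ))))

fromℤ-* : ∀ x y → fromℤ (x * y) ≡ fromℤ x ℚ.* fromℤ y
fromℤ-* x y = sym (ℚₚ.↥p/↧p≡p (fromℤ (x * y)))

fromℤ-sum : ∀ {n} (f : Fin n → ℤ) → fromℤ (ℤΣ.sum f) ≡ ℚΣ.sum (fromℤ ∘ f)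
fromℤ-sum {zero}  f = refl
fromℤ-sum {suc n} f = trans (fromℤ-+ (f zero) _) (cong (fromℤ (f zero) ℚ.+_) (fromℤ-sum (f ∘ suc)))

fromℤ-δ : ∀ {n} (i j : Fin n) → fromℤ (δ i j) ≡ identity i j
fromℤ-δ i j with i ≟ j
... | yes _ = refl
... | no  _ = refl

-- Checked on unnormalised fractions, where `z / d` is not reduced to lowest terms and equality is
-- cross-multiplication.
denominator*/ : ∀ z d .{{_ : ℕ.NonZero d}} → fromℤ (+ d) ℚ.* (z ℚ./ d) ≡ fromℤ z
denominator*/ z (suc d) = ℚₚ.toℚᵘ-injective (ℚᵘₚ.≃-trans
  (ℚₚ.toℚᵘ-homo-* (fromℤ (+ suc d)) (z ℚ./ suc d))
  (ℚᵘₚ.≃-trans (ℚᵘₚ.*-congˡ {ℚᵘ.mkℚᵘ (+ suc d) 0} (ℚₚ.toℚᵘ-fromℚᵘ (ℚᵘ.mkℚᵘ z d)))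
    (ℚᵘ.*≡* (solve 2 (λ x y → x :* y :* con 1ℤ := y :* (con 1ℤ :* x)) refl (+ suc d) z))))

ℚ-*-cancelˡ : ∀ p .{{_ : ℚ.NonZero p}} {x y} → p ℚ.* x ≡ p ℚ.* y → x ≡ y
ℚ-*-cancelˡ p {x} {y} px≡py = trans (sym (unscale x)) (trans (cong ((ℚ.1/ p) ℚ.*_) px≡py) (unscale y))
  where
  unscale : ∀ z → (ℚ.1/ p) ℚ.* (p ℚ.* z) ≡ z
  unscale z = begin
    (ℚ.1/ p) ℚ.* (p ℚ.* z)  ≡⟨ ℚₚ.*-assoc (ℚ.1/ p) p z ⟨
    (ℚ.1/ p) ℚ.* p ℚ.* z    ≡⟨ cong (ℚ._* z) (ℚₚ.*-inverseˡ p) ⟩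
    ℚ.1ℚ ℚ.* z              ≡⟨ ℚₚ.*-identityˡ z ⟩
    z                       ∎

ℚ-*-cancelʳ : ∀ p .{{_ : ℚ.NonZero p}} {x y} → x ℚ.* p ≡ y ℚ.* p → x ≡ y
ℚ-*-cancelʳ p {x} {y} xp≡yp = ℚ-*-cancelˡ p (trans (ℚₚ.*-comm p x) (trans xp≡yp (ℚₚ.*-comm y p)))

-- Inverting a matrix through a rescaling of its rows and columns.

δ-scale : ∀ {n} (x : Fin n → ℤ) i j → δ i j * x j ≡ x i * δ i j
δ-scale x i j with i ≟ j
... | yes refl = ℤₚ.*-comm 1ℤ (x i)
... | no  _    = sym (ℤₚ.*-zeroʳ (x i))

-- With E and F the diagonal matrices of `e` and `f`, X = EAF gives the inverse FYE of A. One
-- product is compared with the identity after scaling row `i` by `e i`, the other after scaling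
-- column `j` by `f j`, so that both computations take place in the integer matrices; the scalars
-- are cancelled at the end.
rescaled-inverse : ∀ {n} (A : Matrix ℚ n) (X Y : Matrix ℤ n) (e f : Fin n → ℤ) →
  (∀ i → ℤ.NonZero (e i)) → (∀ i → ℤ.NonZero (f i)) →
  (∀ i j → fromℤ (e i) ℚ.* A i j ℚ.* fromℤ (f j) ≡ fromℤ (X i j)) →
  (∀ i j → (X · Y) i j ≡ δ i j) → (∀ i j → (Y · X) i j ≡ δ i j) →
  IsInverse A (toℚ λ i j → f i * Y i j * e j)
rescaled-inverse {n} A X Y e f e≢0 f≢0 eAf≡X XY≡δ YX≡δ = AB≡I , BA≡I
  where
  B : Matrix ℤ n
  B i j = f i * Y i j * e j

  AB≡I : ∀ i j → (A ⊗ toℚ B) i j ≡ identity i j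
  AB≡I i j = ℚ-*-cancelˡ (fromℤ (e i)) {{e≢0 i}} (begin
    fromℤ (e i) ℚ.* ℚΣ.sum (λ k → A i k ℚ.* fromℤ (B k j))
      ≡⟨ *-distribˡ-sum (Ring.semiring ℚₚ.+-*-ring) (fromℤ (e i)) (λ k → A i k ℚ.* fromℤ (B k j)) ⟩
    ℚΣ.sum (λ k → fromℤ (e i) ℚ.* (A i k ℚ.* fromℤ (B k j)))
      ≡⟨ ℚΣ.sum-cong-≗ term ⟩
    ℚΣ.sum (λ k → fromℤ (X i k * Y k j * e j))
      ≡⟨ fromℤ-sum (λ k → X i k * Y k j * e j) ⟨
    fromℤ (ℤΣ.sum (λ k → X i k * Y k j * e j))
      ≡⟨ cong fromℤ (*-distribʳ-sum ℤₚ.+-*-semiring (e j) (λ k → X i k * Y k j)) ⟨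
    fromℤ ((X · Y) i j * e j)
      ≡⟨ cong (λ x → fromℤ (x * e j)) (XY≡δ i j) ⟩
    fromℤ (δ i j * e j)
      ≡⟨ cong fromℤ (δ-scale e i j) ⟩
    fromℤ (e i * δ i j)
      ≡⟨ trans (fromℤ-* (e i) (δ i j)) (cong (fromℤ (e i) ℚ.*_) (fromℤ-δ i j)) ⟩
    fromℤ (e i) ℚ.* identity i j
      ∎)
    where
    term : ∀ k → fromℤ (e i) ℚ.* (A i k ℚ.* fromℤ (B k j)) ≡ fromℤ (X i k * Y k j * e j)
    term k = begin
      fromℤ (e i) ℚ.* (A i k ℚ.* fromℤ (f k * Y k j * e j))
        ≡⟨ cong (λ x → fromℤ (e i) ℚ.* (A i k ℚ.* x)) (trans (cong fromℤ (ℤₚ.*-assoc (f k) _ _)) (fromℤ-* (f k) _)) ⟩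
      fromℤ (e i) ℚ.* (A i k ℚ.* (fromℤ (f k) ℚ.* fromℤ (Y k j * e j)))
        ≡⟨ ℚS.solve 4 (λ x y z w → x ℚS.:* (y ℚS.:* (z ℚS.:* w)) ℚS.:= x ℚS.:* y ℚS.:* z ℚS.:* w) refl (fromℤ (e i)) (A i k) (fromℤ (f k)) (fromℤ (Y k j * e j)) ⟩
      fromℤ (e i) ℚ.* A i k ℚ.* fromℤ (f k) ℚ.* fromℤ (Y k j * e j)
        ≡⟨ cong (ℚ._* fromℤ (Y k j * e j)) (eAf≡X i k) ⟩
      fromℤ (X i k) ℚ.* fromℤ (Y k j * e j)
        ≡⟨ fromℤ-* (X i k) _ ⟨
      fromℤ (X i k * (Y k j * e j))
        ≡⟨ cong fromℤ (ℤₚ.*-assoc (X i k) _ _) ⟨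
      fromℤ (X i k * Y k j * e j)
        ∎

  BA≡I : ∀ i j → (toℚ B ⊗ A) i j ≡ identity i j
  BA≡I i j = ℚ-*-cancelʳ (fromℤ (f j)) {{f≢0 j}} (begin
    ℚΣ.sum (λ k → fromℤ (B i k) ℚ.* A k j) ℚ.* fromℤ (f j)
      ≡⟨ *-distribʳ-sum (Ring.semiring ℚₚ.+-*-ring) (fromℤ (f j)) (λ k → fromℤ (B i k) ℚ.* A k j) ⟩
    ℚΣ.sum (λ k → fromℤ (B i k) ℚ.* A k j ℚ.* fromℤ (f j))
      ≡⟨ ℚΣ.sum-cong-≗ term ⟩
    ℚΣ.sum (λ k → fromℤ (f i * (Y i k * X k j)))
      ≡⟨ fromℤ-sum (λ k → f i * (Y i k * X k j)) ⟨
    fromℤ (ℤΣ.sum (λ k → f i * (Y i k * X k j)))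
      ≡⟨ cong fromℤ (*-distribˡ-sum ℤₚ.+-*-semiring (f i) (λ k → Y i k * X k j)) ⟨
    fromℤ (f i * (Y · X) i j)
      ≡⟨ cong (λ x → fromℤ (f i * x)) (YX≡δ i j) ⟩
    fromℤ (f i * δ i j)
      ≡⟨ cong fromℤ (δ-scale f i j) ⟨
    fromℤ (δ i j * f j)
      ≡⟨ trans (fromℤ-* (δ i j) (f j)) (cong (ℚ._* fromℤ (f j)) (fromℤ-δ i j)) ⟩
    identity i j ℚ.* fromℤ (f j)
      ∎)
    where
    term : ∀ k → fromℤ (B i k) ℚ.* A k j ℚ.* fromℤ (f j) ≡ fromℤ (f i * (Y i k * X k j))
    term k = begin
      fromℤ (f i * Y i k * e k) ℚ.* A k j ℚ.* fromℤ (f j)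
        ≡⟨ cong (λ x → x ℚ.* A k j ℚ.* fromℤ (f j)) (fromℤ-* (f i * Y i k) (e k)) ⟩
      fromℤ (f i * Y i k) ℚ.* fromℤ (e k) ℚ.* A k j ℚ.* fromℤ (f j)
        ≡⟨ ℚS.solve 4 (λ x y z w → x ℚS.:* y ℚS.:* z ℚS.:* w ℚS.:= x ℚS.:* (y ℚS.:* z ℚS.:* w)) refl (fromℤ (f i * Y i k)) (fromℤ (e k)) (A k j) (fromℤ (f j)) ⟩
      fromℤ (f i * Y i k) ℚ.* (fromℤ (e k) ℚ.* A k j ℚ.* fromℤ (f j))
        ≡⟨ cong (fromℤ (f i * Y i k) ℚ.*_) (eAf≡X k j) ⟩
      fromℤ (f i * Y i k) ℚ.* fromℤ (X k j)
        ≡⟨ fromℤ-* (f i * Y i k) (X k j) ⟨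
      fromℤ (f i * Y i k * X k j)
        ≡⟨ cong fromℤ (ℤₚ.*-assoc (f i) _ _) ⟩
      fromℤ (f i * (Y i k * X k j))
        ∎

-- The beta matrix as a rescaled product, and the entries of its inverse.

rowScale columnScale : ∀ n → Fin n → ℤ
rowScale    n i = sgn (n ℕ.+ 1-based i) * + ((n C 1-based i) ℕ.* 1-based i)
columnScale n j = + ((n ℕ.+ toℕ j) C toℕ j)

sgn≢0 : ∀ m → ℤ.NonZero (sgn m)
sgn≢0 zero    = _
sgn≢0 (suc m) = ℤₚ.i*j≢0 -1ℤ (sgn m) {{_}} {{sgn≢0 m}}

rowScale≢0 : ∀ n i → ℤ.NonZero (rowScale n i)
rowScale≢0 n i = ℤₚ.i*j≢0 (sgn (n ℕ.+ 1-based i)) _ {{sgn≢0 (n ℕ.+ 1-based i)}}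
  {{ℕₚ.m*n≢0 (n C 1-based i) (1-based i) {{nCk≢0 (toℕ<n i)}}}}

columnScale≢0 : ∀ n j → ℤ.NonZero (columnScale n j)
columnScale≢0 n j = nCk≢0 (ℕₚ.m≤n+m (toℕ j) n)

-- Multiplying by the denominator `d` clears the fraction; what remains is `binomial-factorials`
-- with `p = n - 1 - i`, times a common sign.
rescaled-β : ∀ n i j →
  fromℤ (rowScale n i) ℚ.* betaMatrix n i j ℚ.* fromℤ (columnScale n j)
    ≡ fromℤ ((upper n · lower n) i j)
rescaled-β n i j = ℚ-*-cancelˡ (fromℤ (+ d)) {{d≢0}} (begin
  fromℤ (+ d) ℚ.* (fromℤ e ℚ.* q ℚ.* fromℤ (+ f))
    ≡⟨ ℚS.solve 4 (λ x y z w → x ℚS.:* (y ℚS.:* z ℚS.:* w) ℚS.:= y ℚS.:* (x ℚS.:* z) ℚS.:* w) refl (fromℤ (+ d)) (fromℤ e) q (fromℤ (+ f)) ⟩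
  fromℤ e ℚ.* (fromℤ (+ d) ℚ.* q) ℚ.* fromℤ (+ f)
    ≡⟨ cong (λ x → fromℤ e ℚ.* x ℚ.* fromℤ (+ f)) (denominator*/ (+ (a ! ℕ.* b !)) d {{d≢0}}) ⟩
  fromℤ e ℚ.* fromℤ (+ (a ! ℕ.* b !)) ℚ.* fromℤ (+ f)
    ≡⟨ trans (fromℤ-* (e * + (a ! ℕ.* b !)) (+ f)) (cong (ℚ._* fromℤ (+ f)) (fromℤ-* e _)) ⟨
  fromℤ (e * + (a ! ℕ.* b !) * + f)
    ≡⟨ cong fromℤ integers ⟩
  fromℤ (+ d * (upper n · lower n) i j)
    ≡⟨ fromℤ-* (+ d) _ ⟩
  fromℤ (+ d) ℚ.* fromℤ ((upper n · lower n) i j)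
    ∎)
  where
  a = toℕ i
  b = toℕ j
  p = n ∸ suc a
  -- The denominator of `β (suc a) (suc b)`, in the form to which `suc a + suc b ∸ 1` reduces.
  d = (a ℕ.+ suc b) !
  d≢0 : ℕ.NonZero d
  d≢0 = (a ℕ.+ suc b) ℕₚ.!≢0
  e = rowScale n i
  f = (n ℕ.+ b) C b
  q = betaMatrix n i j
  s = sgn (n ℕ.+ suc a)
  c = (n C suc a) ℕ.* suc a
  c′ = (n ℕ.+ b) C suc (b ℕ.+ a)
  naturals : c ℕ.* (a ! ℕ.* b !) ℕ.* f ≡ c′ ℕ.* d
  naturals = subst
    (λ n → (n C suc a) ℕ.* suc a ℕ.* (a ! ℕ.* b !) ℕ.* ((n ℕ.+ b) C b) ≡ ((n ℕ.+ b) C suc (b ℕ.+ a)) ℕ.* d)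
    (ℕₚ.m+[n∸m]≡n (toℕ<n i)) (binomial-factorials a b p)
  integers : e * + (a ! ℕ.* b !) * + f ≡ + d * (upper n · lower n) i j
  integers = begin
    s * + c * + (a ! ℕ.* b !) * + f
      ≡⟨ solve 4 (λ w x y z → w :* x :* y :* z := w :* (x :* y :* z)) refl s (+ c) (+ (a ! ℕ.* b !)) (+ f) ⟩
    s * (+ c * + (a ! ℕ.* b !) * + f)
      ≡⟨ cong (s *_) (trans (ℤₚ.pos-* (c ℕ.* (a ! ℕ.* b !)) f) (cong (_* + f) (ℤₚ.pos-* c _))) ⟨
    s * + (c ℕ.* (a ! ℕ.* b !) ℕ.* f)
      ≡⟨ cong (λ x → s * + x) naturals ⟩
    s * + (c′ ℕ.* d)
      ≡⟨ cong (s *_) (ℤₚ.pos-* c′ d) ⟩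
    s * (+ c′ * + d)
      ≡⟨ solve 3 (λ x y z → x :* (y :* z) := z :* (x :* y)) refl s (+ c′) (+ d) ⟩
    + d * (s * + c′)
      ≡⟨ cong (+ d *_) (upper·lower n i j) ⟨
    + d * (upper n · lower n) i j
      ∎

-- The two factors are lower and upper triangular, so the terms beyond the smaller of the two
-- indices vanish. The factor `-1ℤ` pays for counting `k` from 1 in the sign.
lower·upper : ∀ n i j → (lower n · upper n) i j ≡
  sgn (toℕ i) * -1ℤ * ℤΣ.sum {1-based i ℕ.⊓ 1-based j} (λ k →
    + ((n ∸ 1-based k) C (n ∸ 1-based i)) * + ((n ℕ.+ toℕ j) C (n ℕ.+ toℕ k)) * sgn (1-based k))
lower·upper n i j = begin
  ℤΣ.sum {n} (λ k → σ * x (toℕ k) * (sgn (toℕ k) * y (toℕ k)))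
    ≡⟨ ℤΣ.sum-cong-≗ {n} (λ k → solve 4 (λ w x u y → w :* x :* (u :* y) := w :* con -1ℤ :* (x :* y :* (con -1ℤ :* u))) refl σ (x (toℕ k)) (sgn (toℕ k)) (y (toℕ k))) ⟩
  ℤΣ.sum {n} (λ k → σ * -1ℤ * g (toℕ k))
    ≡⟨ *-distribˡ-sum ℤₚ.+-*-semiring (σ * -1ℤ) (λ (k : Fin n) → g (toℕ k)) ⟨
  σ * -1ℤ * ℤΣ.sum {n} (g ∘ toℕ)
    ≡⟨ cong (σ * -1ℤ *_) (∑-take {a⊓b} {n} g a⊓b≤n g≡0) ⟨
  σ * -1ℤ * ℤΣ.sum {a⊓b} (g ∘ toℕ)
    ∎
  where
  σ = sgn (toℕ i)
  a⊓b = 1-based i ℕ.⊓ 1-based j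
  a⊓b≤n = ℕₚ.≤-trans (ℕₚ.m⊓n≤m (1-based i) (1-based j)) (toℕ<n i)
  x y g : ℕ → ℤ
  x k = + ((n ∸ suc k) C (n ∸ 1-based i))
  y k = + ((n ℕ.+ toℕ j) C (n ℕ.+ k))
  g k = x k * y k * sgn (suc k)
  g≡0 : ∀ k → a⊓b ≤ k → k < n → g k ≡ 0ℤ
  g≡0 k a⊓b≤k k<n with ℕₚ.⊓-sel (1-based i) (1-based j)
  -- Here `i < k`, so the bottom `n - 1 - i` exceeds the top `n - 1 - k`.
  ... | inj₁ ⊓≡i = cong (λ z → + z * y k * sgn (suc k))
    (k>n⇒nCk≡0 (ℕₚ.∸-monoʳ-< (s<s (subst (_≤ k) ⊓≡i a⊓b≤k)) k<n))
  -- Here `j < k`, so the bottom `n + k` exceeds the top `n + j`.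
  ... | inj₂ ⊓≡j = trans
    (cong (λ z → x k * + z * sgn (suc k)) (k>n⇒nCk≡0 (ℕₚ.+-monoʳ-< n (subst (_≤ k) ⊓≡j a⊓b≤k))))
    (cong (_* sgn (suc k)) (ℤₚ.*-zeroʳ (x k)))

-- In 1-based indices, C(n+i-1, i-1) is the column scaling at `i`, C(n, j) j comes from the row
-- scaling at `j`, and the sum from `lower · upper`. The row scaling contributes the sign (-1)^(n+j)
-- and `lower · upper` the sign (-1)^i.
rescaled-inverseEntry : ∀ n (i j : Fin n) →
  columnScale n i * (lower n · upper n) i j * rowScale n j ≡ inverseEntry n (1-based i) (1-based j)
rescaled-inverseEntry n i j = begin
  f * (lower n · upper n) i j * (sgn (n ℕ.+ suc b) * + (c ℕ.* suc b))
    ≡⟨ cong₂ (λ y e → f * y * e) (lower·upper n i j) (cong₂ _*_ (sgn-+ n (suc b)) (ℤₚ.pos-* c (suc b))) ⟩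
  f * (sgn a * -1ℤ * S) * (sgn n * sgn (suc b) * (+ c * + suc b))
    ≡⟨ solve 7 (λ f a s n b c d → f :* (a :* con -1ℤ :* s) :* (n :* b :* (c :* d)) := n :* (con -1ℤ :* a) :* b :* f :* c :* d :* s) refl
         f (sgn a) S (sgn n) (sgn (suc b)) (+ c) (+ suc b) ⟩
  sgn n * sgn (suc a) * sgn (suc b) * f * + c * + suc b * S
    ≡⟨ cong (λ s → s * f * + c * + suc b * S) sign ⟨
  sgn (n ℕ.+ suc a ∸ suc b) * f * + c * + suc b * S
    ≡⟨ cong₂ (λ x y → sgn (n ℕ.+ suc a ∸ suc b) * + (x C a) * + c * + suc b * y) (pred-+ a) sums ⟨
  inverseEntry n (suc a) (suc b)
    ∎
  where
  a = toℕ i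
  b = toℕ j
  f = columnScale n i
  c = n C suc b
  S = ℤΣ.sum {suc a ℕ.⊓ suc b} (λ k →
    + ((n ∸ 1-based k) C (n ∸ suc a)) * + ((n ℕ.+ b) C (n ℕ.+ toℕ k)) * sgn (1-based k))
  pred-+ : ∀ k → n ℕ.+ suc k ∸ 1 ≡ n ℕ.+ k
  pred-+ k = cong (_∸ 1) (ℕₚ.+-suc n k)
  sign : sgn (n ℕ.+ suc a ∸ suc b) ≡ sgn n * sgn (suc a) * sgn (suc b)
  -- Subtraction agrees with addition modulo 2, and is not truncated here because `suc b ≤ n`.
  sign = trans (sgn-∸ (ℕₚ.≤-trans (toℕ<n j) (ℕₚ.m≤m+n n (suc a)))) (cong (_* sgn (suc b)) (sgn-+ n (suc a)))
  sums : ℤΣ.sum {suc a ℕ.⊓ suc b} (λ k →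
    + ((n ∸ 1-based k) C (n ∸ suc a)) * + ((n ℕ.+ suc b ∸ 1) C (n ℕ.+ 1-based k ∸ 1)) * sgn (1-based k)) ≡ S
  sums = ℤΣ.sum-cong-≗ {suc a ℕ.⊓ suc b} (λ k →
    cong₂ (λ x y → + ((n ∸ 1-based k) C (n ∸ suc a)) * + (x C y) * sgn (1-based k)) (pred-+ b) (pred-+ (toℕ k)))

theorem1p3 : (n : ℕ) .{{_ : NonZero n}} →
    ∃ λ (B : Matrix ℤ n) →
    IsInverse (betaMatrix n) (toℚ B)
    × (∀ i j → B i j ≡ inverseEntry n (1-based i) (1-based j))
theorem1p3 n =
  (λ i j → columnScale n i * (lower n · upper n) i j * rowScale n j) ,
  rescaled-inverse (betaMatrix n) (upper n · lower n) (lower n · upper n) (rowScale n) (columnScale n)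
    (rowScale≢0 n) (columnScale≢0 n) (rescaled-β n)
    (·-involutions-inverse (upper n) (lower n) (upper² n) (lower² n))
    (·-involutions-inverse (lower n) (upper n) (lower² n) (upper² n)) ,
  rescaled-inverseEntry n
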